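{- Let $\mathcal{C}\subseteq 2^{[n]}$ be a code. Given a realization $\mathcal{U} = \{U_1, \ldots, U_n\}$ of $\mathcal{C}$ by boxes in $\mathbb{R}^d$, there exists a realization $\mathcal{V} = \{V_1,\ldots, V_n\}$ of $\mathcal{C}$ by boxes in $\mathbb{R}^d$ with the following properties: (i) each (nonempty) $V_i$ has corners with integer coordinates between $1$ and $2n$; that is, each nonempty $V_i$ is the Cartesian product of closed intervals with integer endpoints between $1$ and $2n$; and (ii) the interiors of the $V_i$ also comprise a realization of $\mathcal{C}$. Moreover, if $\mathcal{C}$ has a realization by interiors of boxes in $\mathbb{R}^d$, then it has a realization by boxes in $\mathbb{R}^d$.
   Context: Write $[n]=\{1,\ldots,n\}$. A code is a set $\mathcal{C}\subseteq 2^{[n]}$. For an ordered (indexed) collection $\mathcal{U} = \{U_1, \ldots, U_n\}$ of sets in $\mathbb{R}^d$, where $d\ge 1$, its code is $$\operatorname{code}(\mathcal{U}) = \{\sigma\subseteq [n] \mid \text{there exists } p\in \mathbb{R}^d \text{ such that for all } i\in[n],\ p\in U_i \text{ if and only if } i\in\sigma\},$$ and $\mathcal{U}$ is called a realization of $\operatorname{code}(\mathcal{U})$. An axis-parallel box (box for short) in $\mathbb{R}^d$ is either the empty set or a product $[a_1,b_1]\times\cdots\times[a_d,b_d]$ of nonempty closed intervals (degenerate intervals $a_i=b_i$ allowed). Interiors are taken in $\mathbb{R}^d$. -}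

module Defs where

open import Data.Fin.Subset using (Subset) renaming (_∈_ to _∈ₛ_)
open import Data.Integer.Base using (ℤ)
open import Data.Nat.Base using (ℕ)
open import Data.Product.Base using (_×_; _,_; ∃; ∃₂; ∃-syntax)
open import Data.Rational.Base using (ℚ; 1ℚ)
import Data.Rational.Base as ℚ
import Data.Rational.Literals as ℚ using (fromℤ)
import Data.Rational.Properties as ℚ
open import Data.Sum.Base using (_⊎_; inj₁; inj₂)
open import Data.Vec.Functional using (Vector)
open import Function.Bundles using (_⇔_; mk⇔)
open import Level using (Level; 0ℓ; suc; _⊔_)
open import Relation.Binary.Definitions using (tri<; tri≈; tri>)
open import Relation.Binary.PropositionalEquality using (subst; refl)
open import Relation.Nullary using (¬_)
open import Relation.Unary using (Pred; _∈_; _⊆_; _≐_; Empty)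

private
  variable
    ℓ ℓ′ : Level
    n d : ℕ

-- Two-sided Dedekind cuts.
record ℝ : Set₁ where
  field
    lower upper     : Pred ℚ 0ℓ
    lower-inhabited : ∃ lower
    upper-inhabited : ∃ upper
    lower-rounded   : ∀ q → lower q ⇔ (∃[ r ] q ℚ.< r × lower r)
    upper-rounded   : ∀ q → upper q ⇔ (∃[ r ] r ℚ.< q × upper r)
    disjoint        : ∀ q → ¬ (lower q × upper q)
    located         : ∀ q r → q ℚ.< r → lower q ⊎ upper r

open ℝ

infix 4 _≤_ _<_

_≤_ : ℝ → ℝ → Set
x ≤ y = lower x ⊆ lower y

_<_ : ℝ → ℝ → Set
x < y = ∃[ q ] upper x q × lower y q

fromℚ : ℚ → ℝ
fromℚ p = record
  { lower           = λ q → q ℚ.< p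
  ; upper           = λ q → p ℚ.< q
  ; lower-inhabited = p ℚ.- 1ℚ , p-1<p
  ; upper-inhabited = p ℚ.+ 1ℚ , p<p+1
  ; lower-rounded   = λ q → mk⇔ (λ q<p → ℚ.<-dense q<p)
                                (λ (r , q<r , r<p) → ℚ.<-trans q<r r<p)
  ; upper-rounded   = λ q → mk⇔ (λ p<q → let r , p<r , r<q = ℚ.<-dense p<q in r , r<q , p<r)
                                (λ (r , r<q , p<r) → ℚ.<-trans p<r r<q)
  ; disjoint        = λ q (q<p , p<q) → ℚ.<-asym q<p p<q
  ; located         = locate
  }
  where
  p-1<p : p ℚ.- 1ℚ ℚ.< p
  p-1<p = subst (p ℚ.- 1ℚ ℚ.<_) (ℚ.+-identityʳ p)
            (ℚ.+-monoʳ-< p (ℚ.negative⁻¹ (ℚ.- 1ℚ)))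

  p<p+1 : p ℚ.< p ℚ.+ 1ℚ
  p<p+1 = subst (ℚ._< p ℚ.+ 1ℚ) (ℚ.+-identityʳ p)
            (ℚ.+-monoʳ-< p (ℚ.positive⁻¹ 1ℚ))

  locate : ∀ q r → q ℚ.< r → q ℚ.< p ⊎ p ℚ.< r
  locate q r q<r with ℚ.<-cmp q p
  ... | tri< q<p _ _    = inj₁ q<p
  ... | tri≈ _ refl _   = inj₂ q<r
  ... | tri> _ _ p<q    = inj₂ (ℚ.<-trans p<q q<r)

fromℤ : ℤ → ℝ
fromℤ m = fromℚ (ℚ.fromℤ m)

Point : ℕ → Set₁
Point d = Vector ℝ d

closedBox openBox : Point d → Point d → Pred (Point d) 0ℓ
closedBox a b p = ∀ j → a j ≤ p j × p j ≤ b j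
openBox   a b p = ∀ j → a j < p j × p j < b j

IsBox : Pred (Point d) ℓ → Set (suc 0ℓ ⊔ ℓ)
IsBox S = Empty S ⊎ ∃₂ λ a b → (∀ j → a j ≤ b j) × S ≐ closedBox a b

-- Open boxes form a basis of the usual topology of ℝᵈ.
interior : Pred (Point d) ℓ → Pred (Point d) (suc 0ℓ ⊔ ℓ)
interior S p = ∃₂ λ l u → p ∈ openBox l u × openBox l u ⊆ S

-- The index set [n] is Fin n, so codewords are elements of Subset n.
Code : ℕ → (ℓ : Level) → Set (suc ℓ)
Code n ℓ = Pred (Subset n) ℓ

code : Vector (Pred (Point d) ℓ) n → Code n (suc 0ℓ ⊔ ℓ)
code 𝒰 σ = ∃[ p ] ∀ i → p ∈ 𝒰 i ⇔ i ∈ₛ σ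

infix 4 _Realizes_

_Realizes_ : Vector (Pred (Point d) ℓ) n → Code n ℓ′ → Set (suc 0ℓ ⊔ ℓ ⊔ ℓ′)
𝒰 Realizes 𝒞 = code 𝒰 ≐ 𝒞

module Submission where

-- Per coordinate, place each endpoint x of a box just below (x⁻) or just above (x⁺)
-- the real x: a point lies in [a , b] iff it is beyond a⁻ but not beyond b⁺, and in
-- (a , b) iff it is beyond a⁺ but not beyond b⁻.  Any initial segment of a finite set
-- of such cuts is the set of cuts below some real, so the code depends only on the
-- relative order of the cuts in each coordinate.  Ranks realise the same order with
-- integers in 1..2n.  Since x⁻ and y⁺ are never equivalent, lower and upper endpoints
-- have distinct ranks, and therefore either choice of signs may be put on the ranks.

open import Defs
open import Axiom.ExcludedMiddle using (ExcludedMiddle)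
open import Data.Fin.Base using (Fin; zero; suc; combine; remQuot)
open import Data.Fin.Properties using (remQuot-combine)
open import Data.Fin.Subset using (Subset; ∣_∣) renaming (_∈_ to _∈ₛ_)
open import Data.Fin.Subset.Properties using (∣p∣≤n; p⊆q⇒∣p∣≤∣q∣; p⊂q⇒∣p∣<∣q∣; x∈p⇒∣p-x∣<∣p∣)
open import Data.Integer.Base using (ℤ; +_; +≤+; +<+) renaming (_≤_ to _≤ᶻ_; _<_ to _<ᶻ_)
import Data.Integer.Properties as ℤ
open import Data.Nat.Base using (ℕ; _*_; s≤s; z≤n) renaming (_≤_ to _≤ⁿ_)
import Data.Nat.Properties as ℕ
open import Data.Product.Base using (_×_; _,_; proj₁; proj₂; ∃₂; ∃-syntax; Σ-syntax)
open import Data.Rational.Base using (0ℚ; *<*; *≤*)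
import Data.Rational.Base as ℚ
import Data.Rational.Properties as ℚ
open import Data.Sign.Base using (Sign; opposite) renaming (- to ⁻; + to ⁺)
open import Data.Sum.Base using (_⊎_; inj₁; inj₂)
open import Data.Vec.Base using (tabulate)
open import Data.Vec.Functional using (Vector)
open import Data.Vec.Properties using ([]=⇒lookup; lookup⇒[]=; lookup∘tabulate)
open import Function.Base using (_∘_; id; flip)
open import Function.Bundles using (_⇔_; mk⇔; Equivalence)
open import Function.Definitions using (StrictlySurjective)
open import Function.Properties.Equivalence using () renaming (trans to ⇔-trans)
open import Level using (Level; 0ℓ)
open import Relation.Binary.Core using (Rel)
open import Relation.Binary.Definitions using (Reflexive; Total; Transitive; tri<; tri≈; tri>)
open import Relation.Binary.PropositionalEquality using (_≡_; refl; sym; trans; subst; subst₂)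
open import Relation.Nullary using (¬_; does; yes; no; contradiction)
open import Relation.Nullary.Decidable using (decidable-stable; dec-true)
open import Relation.Unary using (Pred; Satisfiable; Decidable; _∈_; _⊆_; _≐_)
open import Relation.Unary.Properties using (≐-sym; ≐-trans)

open ℝ
open Equivalence using (to; from)

private
  variable
    ℓ ℓ′ : Level
    n d m : ℕ
    x y z : ℝ

-- The order of the reals

lower-closed : ∀ (x : ℝ) {q r} → q ℚ.< r → lower x r → lower x q
lower-closed x q<r r∈x = lower-rounded x _ .from (_ , q<r , r∈x)

lower<upper : ∀ (x : ℝ) {q r} → lower x q → upper x r → q ℚ.< r
lower<upper x {q} {r} q∈L r∈U with ℚ.<-cmp q r
... | tri< q<r _ _  = q<r
... | tri≈ _ refl _ = contradiction (q∈L , r∈U) (disjoint x q)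
... | tri> _ _ r<q  = contradiction (lower-closed x r<q q∈L , r∈U) (disjoint x r)

<⇒≤ : x < y → x ≤ y
<⇒≤ {x} {y} (q , x<q , q<y) r<x = lower-closed y (lower<upper x r<x x<q) q<y

<-≤-trans : x < y → y ≤ z → x < z
<-≤-trans (q , x<q , q<y) y≤z = q , x<q , y≤z q<y

-- As `≤` compares lower cuts only, the upper cut of `x` is reached by locatedness: a rational `r`
-- above `y` cannot lie below `x`.
≤-<-trans : x ≤ y → y < z → x < z
≤-<-trans {x} {y} x≤y (q , y<q , q<z)
  with r , r<q , y<r ← upper-rounded y q .to y<q | located x r q r<q
... | inj₁ r<x = contradiction (x≤y r<x , y<r) (disjoint y r)
... | inj₂ x<q = q , x<q , q<z

<-irrefl : ¬ x < x
<-irrefl {x} (q , x<q , q<x) = disjoint x q (q<x , x<q)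

<⇒≱ : x < y → ¬ y ≤ x
<⇒≱ {x} {y} x<y y≤x = <-irrefl {x} (<-≤-trans {x} {y} {x} x<y y≤x)

≮⇒≥ : ¬ y < x → x ≤ y
≮⇒≥ {y} {x} y≮x {q} q<x with r , q<r , r<x ← lower-rounded x q .to q<x | located y q r q<r
... | inj₁ q<y = q<y
... | inj₂ y<r = contradiction (r , y<r , r<x) y≮x

<-fromℚ : ∀ (x : ℝ) {q} → upper x q → x < fromℚ q
<-fromℚ x {q} x<q with r , r<q , x<r ← upper-rounded x q .to x<q = r , x<r , r<q

fromℚ-< : ∀ (x : ℝ) {q} → lower x q → fromℚ q < x
fromℚ-< x {q} q<x with r , q<r , r<x ← lower-rounded x q .to q<x = r , q<r , r<x

fromℤ-mono-≤ : ∀ {i j} → i ≤ᶻ j → fromℤ i ≤ fromℤ j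
fromℤ-mono-≤ i≤j q<i =
  ℚ.<-≤-trans q<i (*≤* (subst₂ _≤ᶻ_ (sym (ℤ.*-identityʳ _)) (sym (ℤ.*-identityʳ _)) i≤j))

fromℤ-mono-< : ∀ {i j} → i <ᶻ j → fromℤ i < fromℤ j
fromℤ-mono-< i<j with q , i<q , q<j ← ℚ.<-dense
  (*<* (subst₂ _<ᶻ_ (sym (ℤ.*-identityʳ _)) (sym (ℤ.*-identityʳ _)) i<j)) = q , i<q , q<j

fromℤ-cancel-≤ : ∀ {i j} → fromℤ i ≤ fromℤ j → i ≤ᶻ j
fromℤ-cancel-≤ {i} {j} i≤j with i ℤ.≤? j
... | yes p  = p
... | no i≰j = contradiction (λ {q} → i≤j {q}) (<⇒≱ {fromℤ j} {fromℤ i} (fromℤ-mono-< (ℤ.≰⇒> i≰j)))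

-- Cuts

-- (x , ⁻) and (x , ⁺) are the cuts just below and just above x; a cut e lies below the
-- real p exactly when e ⊑ (p , ⁻).
Cut : Set₁
Cut = ℝ × Sign

infix 4 _⊑_

-- The lexicographic order with `⁻` before `⁺`; the signs tell whether a tie `x = y` is allowed,
-- which avoids a disjunction.
_⊑_ : Rel Cut 0ℓ
(x , ⁻) ⊑ (y , _) = x ≤ y
(x , ⁺) ⊑ (y , ⁻) = x < y
(x , ⁺) ⊑ (y , ⁺) = x ≤ y

⊑-refl : Reflexive _⊑_
⊑-refl {x , ⁻} = id
⊑-refl {x , ⁺} = id

<⇒⊑ : ∀ s t → x < y → (x , s) ⊑ (y , t)
<⇒⊑ {x} {y} ⁻ _ x<y = <⇒≤ {x} {y} x<y
<⇒⊑         ⁺ ⁻ x<y = x<y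
<⇒⊑ {x} {y} ⁺ ⁺ x<y = <⇒≤ {x} {y} x<y

≤⇒⊑ : ∀ s → x ≤ y → (x , s) ⊑ (y , s)
≤⇒⊑ ⁻ x≤y = x≤y
≤⇒⊑ ⁺ x≤y = x≤y

⊑⇒≤ : ∀ s t → (x , s) ⊑ (y , t) → x ≤ y
⊑⇒≤         ⁻ _ x≤y = x≤y
⊑⇒≤ {x} {y} ⁺ ⁻ x<y = <⇒≤ {x} {y} x<y
⊑⇒≤         ⁺ ⁺ x≤y = x≤y

⊑-trans : Transitive _⊑_
⊑-trans {x , ⁻} {y , s} {z , t} e⊑f f⊑g q<x = ⊑⇒≤ {y} {z} s t f⊑g (e⊑f q<x)
⊑-trans {x , ⁺} {y , ⁻} {z , t} e⊑f f⊑g = <⇒⊑ {x} {z} ⁺ t (<-≤-trans {x} {y} {z} e⊑f f⊑g)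
⊑-trans {x , ⁺} {y , ⁺} {z , ⁻} e⊑f f⊑g = ≤-<-trans {x} {y} {z} e⊑f f⊑g
⊑-trans {x , ⁺} {y , ⁺} {z , ⁺} e⊑f f⊑g q<x = f⊑g (e⊑f q<x)

-- Different signs would make `x ≤ y` and `y < x` hold together, or `x < y` and `y ≤ x`.
⊑-antisym-sign : ∀ {s t} → (x , s) ⊑ (y , t) → (y , t) ⊑ (x , s) → s ≡ t
⊑-antisym-sign         {s = ⁻} {⁻} _   _   = refl
⊑-antisym-sign {x} {y} {s = ⁻} {⁺} x≤y y<x = contradiction (λ {q} → x≤y {q}) (<⇒≱ {y} {x} y<x)
⊑-antisym-sign {x} {y} {s = ⁺} {⁻} x<y y≤x = contradiction (λ {q} → y≤x {q}) (<⇒≱ {x} {y} x<y)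
⊑-antisym-sign         {s = ⁺} {⁺} _   _   = refl

real-above : ∀ e → ∃[ p ] e ⊑ (p , ⁻)
real-above (x , s) with q , x<q ← upper-inhabited x = fromℚ q , <⇒⊑ s ⁻ (<-fromℚ x x<q)

real-below : ∀ e → ∃[ p ] ¬ e ⊑ (p , ⁻)
real-below (x , s) with q , q<x ← lower-inhabited x =
  fromℚ q , λ x⊑q → <⇒≱ {fromℚ q} {x} (fromℚ-< x q<x) (⊑⇒≤ {x} {fromℚ q} s ⁻ x⊑q)

-- Boxes

-- The indices of the lower endpoints of n boxes are (zero , i), of the upper ones (suc zero , i).
End : ℕ → Set
End n = Fin 2 × Fin n

-- The argument is the sign of the lower ends: `⁻` encodes closed boxes, `⁺` open ones.
end-sign : Sign → End n → Sign
end-sign s (zero  , _) = s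
end-sign s (suc _ , _) = opposite s

-- Equal signs mean that both ends are lower or both are upper, whichever sign the lower ends carry.
end-sign-cong : ∀ s t (c c′ : End n) → end-sign s c ≡ end-sign s c′ → end-sign t c ≡ end-sign t c′
end-sign-cong s t (zero     , _) (zero     , _) _ = refl
end-sign-cong ⁻ t (zero     , _) (suc _    , _) ()
end-sign-cong ⁺ t (zero     , _) (suc _    , _) ()
end-sign-cong ⁻ t (suc _    , _) (zero     , _) ()
end-sign-cong ⁺ t (suc _    , _) (zero     , _) ()
end-sign-cong s t (suc _    , _) (suc _    , _) _ = refl

Ends : ℕ → ℕ → Set₁
Ends n d = Fin d → End n → ℝ

ends : Vector (Point d) n → Vector (Point d) n → Ends n d
ends a b j (zero  , i) = a i j
ends a b j (suc _ , i) = b i j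

lo hi : Ends n d → Vector (Point d) n
lo x i j = x j (zero , i)
hi x i j = x j (suc zero , i)

cuts : Sign → Ends n d → Fin d → End n → Cut
cuts s x j c = x j c , end-sign s c

box : Sign → Ends n d → Vector (Pred (Point d) 0ℓ) n
box s x i p = ∀ j → cuts s x j (zero , i) ⊑ (p j , ⁻) × ¬ cuts s x j (suc zero , i) ⊑ (p j , ⁻)

interior-closedBox : (a b : Point d) → interior (closedBox a b) ≐ openBox a b
interior-closedBox a b = (λ {p} → ⊆-open {p}) , (λ {p} → ⊇-open {p})
  where
  -- A rational point strictly between l and p lies in the closed box, as does one between p and u.
  ⊆-open : interior (closedBox a b) ⊆ openBox a b
  ⊆-open {p} (l , u , p∈lu , lu⊆ab) j = a<p , p<b
    where
    l<p = proj₁ ∘ p∈lu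
    p<u = proj₂ ∘ p∈lu

    below above : Point _
    below j = fromℚ (proj₁ (l<p j))
    above j = fromℚ (proj₁ (p<u j))

    l<below : ∀ j → l j < below j
    l<below j = <-fromℚ (l j) (proj₁ (proj₂ (l<p j)))

    below<p : ∀ j → below j < p j
    below<p j = fromℚ-< (p j) (proj₂ (proj₂ (l<p j)))

    p<above : ∀ j → p j < above j
    p<above j = <-fromℚ (p j) (proj₁ (proj₂ (p<u j)))

    above<u : ∀ j → above j < u j
    above<u j = fromℚ-< (u j) (proj₂ (proj₂ (p<u j)))

    a<p : a j < p j
    a<p = ≤-<-trans {a j} {below j} {p j} (proj₁ (lu⊆ab {below} below∈lu j)) (below<p j)
      where
      below∈lu : below ∈ openBox l u
      below∈lu k = l<below k ,
        ≤-<-trans {below k} {p k} {u k} (<⇒≤ {below k} {p k} (below<p k)) (p<u k)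

    p<b : p j < b j
    p<b = <-≤-trans {p j} {above j} {b j} (p<above j) (proj₂ (lu⊆ab {above} above∈lu j))
      where
      above∈lu : above ∈ openBox l u
      above∈lu k =
        ≤-<-trans {l k} {p k} {above k} (<⇒≤ {l k} {p k} (l<p k)) (p<above k) , above<u k

  ⊇-open : openBox a b ⊆ interior (closedBox a b)
  ⊇-open p∈ab = a , b , p∈ab , λ {q} q∈ab j →
    <⇒≤ {a j} {q j} (proj₁ (q∈ab j)) , <⇒≤ {q j} {b j} (proj₂ (q∈ab j))

interior-cong : {S : Pred (Point d) ℓ} {T : Pred (Point d) ℓ′} → S ≐ T → interior S ≐ interior T
interior-cong (S⊆T , T⊆S) =
  (λ (l , u , p∈lu , lu⊆S) → l , u , p∈lu , λ q∈lu → S⊆T (lu⊆S q∈lu)) ,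
  (λ (l , u , p∈lu , lu⊆T) → l , u , p∈lu , λ q∈lu → T⊆S (lu⊆T q∈lu))

code-cong : {𝒰 : Vector (Pred (Point d) ℓ) n} {𝒱 : Vector (Pred (Point d) ℓ′) n} →
            (∀ i → 𝒰 i ≐ 𝒱 i) → code 𝒰 ≐ code 𝒱
code-cong 𝒰≐𝒱 =
  (λ (p , h) → p , λ i → ⇔-trans (mk⇔ (proj₂ (𝒰≐𝒱 i)) (proj₁ (𝒰≐𝒱 i))) (h i)) ,
  (λ (p , h) → p , λ i → ⇔-trans (mk⇔ (proj₁ (𝒰≐𝒱 i)) (proj₂ (𝒰≐𝒱 i))) (h i))

-- An empty box is also the closed box with all lower ends 1 and all upper ends 0, as d ≥ 1.
isBox⇒closedBox : 1 ≤ⁿ d → {S : Pred (Point d) ℓ} → IsBox S → ∃₂ λ a b → S ≐ closedBox a b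
isBox⇒closedBox (s≤s _) (inj₁ empty) =
  (λ _ → fromℤ (+ 1)) , (λ _ → fromℤ (+ 0)) ,
  (λ p∈S → contradiction p∈S (empty _)) ,
  (λ {p} p∈ab → contradiction {A = fromℤ (+ 1) ≤ fromℤ (+ 0)}
     (λ q<1 → proj₂ (p∈ab zero) (proj₁ (p∈ab zero) q<1))
     (<⇒≱ {fromℤ (+ 0)} {fromℤ (+ 1)} (fromℤ-mono-< (+<+ (s≤s z≤n)))))
isBox⇒closedBox _ (inj₂ (a , b , _ , S≐ab)) = a , b , S≐ab

-- Maxima of finite families

maximum : {A : Set ℓ} {_≲_ : Rel A ℓ′} → Total _≲_ → Transitive _≲_ → Reflexive _≲_ →
          (e : Fin m → A) {P : Pred (Fin m) 0ℓ} → Decidable P →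
          (∀ k → ¬ P k) ⊎ (∃[ k ] P k × (∀ l → P l → e l ≲ e k))
maximum {m = ℕ.zero} tot tr rf e P? = inj₁ λ ()
maximum {m = ℕ.suc m} tot tr rf e P? with P? zero | maximum tot tr rf (e ∘ suc) (P? ∘ suc)
... | no ¬p0 | inj₁ none = inj₁ λ { zero → ¬p0 ; (suc k) → none k }
... | yes p0 | inj₁ none =
  inj₂ (zero , p0 , λ { zero _ → rf ; (suc l) pl → contradiction pl (none l) })
... | no ¬p0 | inj₂ (k , pk , max) =
  inj₂ (suc k , pk , λ { zero p0 → contradiction p0 ¬p0 ; (suc l) → max l })
... | yes p0 | inj₂ (k , pk , max) with tot (e zero) (e (suc k))
...   | inj₁ 0≲k = inj₂ (suc k , pk , λ { zero _ → 0≲k ; (suc l) → max l })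
...   | inj₂ k≲0 = inj₂ (zero , p0 , λ { zero _ → rf ; (suc l) pl → tr (max l pl) k≲0 })

-- Cuts and boxes under excluded middle

module Classical (em : ExcludedMiddle 0ℓ) where

  ≰⇒> : ¬ x ≤ y → y < x
  ≰⇒> {x} {y} x≰y = decidable-stable em λ y≮x → x≰y λ {q} → ≮⇒≥ {y} {x} y≮x {q}

  ⊑-total : Total _⊑_
  ⊑-total (x , s) (y , t) with em {x < y} | em {y < x}
  ... | yes x<y | _       = inj₁ (<⇒⊑ {x} {y} s t x<y)
  ... | no _    | yes y<x = inj₂ (<⇒⊑ {y} {x} t s y<x)
  -- Here `x` and `y` are equal as reals, so the signs decide.
  ... | no x≮y  | no y≮x with s | t
  ...   | ⁻ | _ = inj₁ λ {q} → ≮⇒≥ {y} {x} y≮x {q}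
  ...   | ⁺ | ⁻ = inj₂ λ {q} → ≮⇒≥ {x} {y} x≮y {q}
  ...   | ⁺ | ⁺ = inj₁ λ {q} → ≮⇒≥ {y} {x} y≮x {q}

  -- The real `x` separates `x⁻` from every cut not below it, and `y` separates `x⁺` from `y⁺` when
  -- `x < y`. Between `x⁺` and `y⁻` a rational from the witness of `x < y` is taken.
  ⊑-separated : ∀ e f → ¬ f ⊑ e → ∃[ p ] e ⊑ (p , ⁻) × ¬ f ⊑ (p , ⁻)
  ⊑-separated (x , ⁻) f       f⋢x = x , id , f⋢x
  ⊑-separated (x , ⁺) (y , ⁻) y≰x with q , x<q , q<y ← ≰⇒> {y} {x} y≰x =
    fromℚ q , <-fromℚ x x<q , <⇒≱ {fromℚ q} {y} (fromℚ-< y q<y)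
  ⊑-separated (x , ⁺) (y , ⁺) y≰x = y , ≰⇒> {y} {x} y≰x , <-irrefl {y}

  -- A real separating the greatest cut in `D` from the least cut outside it serves. If one of the
  -- two is missing, a real beyond the other does.
  initial-segment-real :
    (e : Fin m → Cut) (D : Pred (Fin m) 0ℓ) → (∀ k l → D k → ¬ D l → ¬ e l ⊑ e k) →
    ∃[ p ] ∀ k → D k ⇔ e k ⊑ (p , ⁻)
  initial-segment-real e D D⊏∁D =
    let p , above , below = real
    in p , λ k → mk⇔ (above k) (λ k⊑p → decidable-stable em λ k∉D → below k k∉D k⊑p)
    where
    real : ∃[ p ] (∀ k → D k → e k ⊑ (p , ⁻)) × (∀ k → ¬ D k → ¬ e k ⊑ (p , ⁻))
    -- The second search finds the least cut outside `D`, as a maximum for the reversed order.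
    real with maximum ⊑-total (λ {e} {f} {g} → ⊑-trans {e} {f} {g}) (λ {e} → ⊑-refl {e}) e
                      {D} (λ _ → em)
            | maximum {_≲_ = flip _⊑_} (flip ⊑-total)
                      (λ {e} {f} {g} f⊑e g⊑f → ⊑-trans {g} {f} {e} g⊑f f⊑e)
                      (λ {e} → ⊑-refl {e}) e {λ k → ¬ D k} (λ _ → em)
    ... | inj₁ ∄D | inj₁ ∄∁D =
      -- There is no index at all, so any real will do.
      fromℚ 0ℚ , (λ k k∈D → contradiction k∈D (∄D k)) , (λ k k∉D → contradiction k∉D (∄∁D k))
    ... | inj₁ ∄D | inj₂ (l , _ , min) with p , l⋢p ← real-below (e l) =
      p , (λ k k∈D → contradiction k∈D (∄D k)) ,
      (λ k k∉D k⊑p → l⋢p (⊑-trans {e l} {e k} {p , ⁻} (min k k∉D) k⊑p))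
    ... | inj₂ (l , _ , max) | inj₁ ∄∁D with p , l⊑p ← real-above (e l) =
      p , (λ k k∈D → ⊑-trans {e k} {e l} {p , ⁻} (max k k∈D) l⊑p) ,
      (λ k k∉D → contradiction k∉D (∄∁D k))
    ... | inj₂ (l , l∈D , max) | inj₂ (l′ , l′∉D , min)
      with p , l⊑p , l′⋢p ← ⊑-separated (e l) (e l′) (D⊏∁D l l′ l∈D l′∉D) =
      p , (λ k k∈D → ⊑-trans {e k} {e l} {p , ⁻} (max k k∈D) l⊑p) ,
      (λ k k∉D k⊑p → l′⋢p (⊑-trans {e l′} {e k} {p , ⁻} (min k k∉D) k⊑p))

  closedBox-isBox : (a b : Point d) → IsBox (closedBox a b)
  closedBox-isBox a b with em {∀ j → a j ≤ b j}
  ... | yes a≤b = inj₂ (a , b , (λ j {q} → a≤b j {q}) , id , id)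
  ... | no  a≰b = inj₁ λ p p∈ab → a≰b λ j q<a → proj₂ (p∈ab j) (proj₁ (p∈ab j) q<a)

  box⁻≐closedBox : (x : Ends n d) → ∀ i → box ⁻ x i ≐ closedBox (lo x i) (hi x i)
  box⁻≐closedBox x i =
    (λ {p} p∈box j → proj₁ (p∈box j) ,
       λ {q} → ≮⇒≥ {hi x i j} {p j} (proj₂ (p∈box j)) {q}) ,
    (λ {p} p∈box j → proj₁ (p∈box j) ,
       λ hi<p → <⇒≱ {hi x i j} {p j} hi<p (proj₂ (p∈box j)))

  box⁺≐openBox : (x : Ends n d) → ∀ i → box ⁺ x i ≐ openBox (lo x i) (hi x i)
  box⁺≐openBox x i =
    (λ {p} p∈box j → proj₁ (p∈box j) , ≰⇒> {hi x i j} {p j} (proj₂ (p∈box j))) ,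
    (λ {p} p∈box j → proj₁ (p∈box j) , <⇒≱ {p j} {hi x i j} (proj₂ (p∈box j)))

  -- Order transfer and ranks over a finite index set

  module _ {I : Set} {f : Fin m → I} (f-surj : StrictlySurjective _≡_ f) where

    -- Because order is reflected from `e′` to `e`, the indices whose `e`-cut lies below `p` form an
    -- initial segment for `e′`, which some real `p′` realises.
    order-transfer : (e e′ : I → Cut) → (∀ c c′ → e′ c ⊑ e′ c′ → e c ⊑ e c′) →
                     ∀ p → ∃[ p′ ] ∀ c → e c ⊑ (p , ⁻) ⇔ e′ c ⊑ (p′ , ⁻)
    order-transfer e e′ reflects p
      with p′ , h ← initial-segment-real (e′ ∘ f) (λ k → e (f k) ⊑ (p , ⁻))
             (λ k l k⊑p l⋢p l⊑k →
                l⋢p (⊑-trans {e (f l)} {e (f k)} {p , ⁻} (reflects (f l) (f k) l⊑k) k⊑p))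
      = p′ , λ c → subst (λ c → e c ⊑ (p , ⁻) ⇔ e′ c ⊑ (p′ , ⁻)) (proj₂ (f-surj c)) (h _)

    module _ (e : I → Cut) where

      -- A principal down-set, recorded by indices of the enumeration `f` so that its size is at
      -- most `m`.
      down : I → Subset m
      down c = tabulate λ k → does (em {e (f k) ⊑ e c})

      ∈-down⁺ : ∀ {c k} → e (f k) ⊑ e c → k ∈ₛ down c
      ∈-down⁺ {c} {k} k⊑c =
        lookup⇒[]= k _ (trans (lookup∘tabulate _ k) (dec-true em k⊑c))

      ∈-down⁻ : ∀ {c k} → k ∈ₛ down c → e (f k) ⊑ e c
      ∈-down⁻ {c} {k} k∈ with em {e (f k) ⊑ e c} | trans (sym (lookup∘tabulate _ k)) ([]=⇒lookup k∈)
      ... | yes k⊑c | _ = k⊑c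

      rank : I → ℕ
      rank c = ∣ down c ∣

      rank≤m : ∀ c → rank c ≤ⁿ m
      rank≤m c = ∣p∣≤n (down c)

      -- An index of `c` itself belongs to `down c`.
      1≤rank : ∀ c → 1 ≤ⁿ rank c
      1≤rank c with k , refl ← f-surj c =
        ℕ.≤-<-trans z≤n (x∈p⇒∣p-x∣<∣p∣ (∈-down⁺ (⊑-refl {e (f k)})))

      rank-mono-≤ : ∀ {c c′} → e c ⊑ e c′ → rank c ≤ⁿ rank c′
      rank-mono-≤ {c} {c′} c⊑c′ =
        p⊆q⇒∣p∣≤∣q∣ λ {k} k∈ → ∈-down⁺ (⊑-trans {e (f k)} {e c} {e c′} (∈-down⁻ k∈) c⊑c′)

      -- Otherwise totality puts `e c′` strictly below `e c`. Then `down c′` is a proper subset of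
      -- `down c`, lacking an index of `c`, and its size is smaller.
      rank-cancel-≤ : ∀ {c c′} → rank c ≤ⁿ rank c′ → e c ⊑ e c′
      rank-cancel-≤ {c} {c′} r≤r′ with ⊑-total (e c) (e c′) | f-surj c
      ... | inj₁ c⊑c′ | _ = c⊑c′
      ... | inj₂ c′⊑c | k , refl = decidable-stable em λ c⋢c′ → ℕ.<⇒≱ (p⊂q⇒∣p∣<∣q∣
        ( (λ {l} l∈ → ∈-down⁺ (⊑-trans {e (f l)} {e c′} {e c} (∈-down⁻ l∈) c′⊑c))
        , k , ∈-down⁺ (⊑-refl {e c}) , c⋢c′ ∘ ∈-down⁻)) r≤r′

      -- Distinct ranks order the cuts whatever their signs. Equal ranks come from equivalent cuts,
      -- which `σ` gives equal signs.
      rank-cut-order : (σ : I → Sign) → (∀ c c′ → e c ⊑ e c′ → e c′ ⊑ e c → σ c ≡ σ c′) →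
        ∀ c c′ → e c ⊑ e c′ ⇔ (fromℤ (+ rank c) , σ c) ⊑ (fromℤ (+ rank c′) , σ c′)
      rank-cut-order σ σ-cong c c′ = mk⇔ mono cancel
        where
        mono : e c ⊑ e c′ → (fromℤ (+ rank c) , σ c) ⊑ (fromℤ (+ rank c′) , σ c′)
        mono c⊑c′ with ℕ.m≤n⇒m<n∨m≡n (rank-mono-≤ c⊑c′)
        ... | inj₁ r<r′ = <⇒⊑ (σ c) (σ c′) (fromℤ-mono-< (+<+ r<r′))
        ... | inj₂ r≡r′ =
          subst (λ s → (fromℤ (+ rank c) , σ c) ⊑ (fromℤ (+ rank c′) , s))
            (σ-cong c c′ c⊑c′ (rank-cancel-≤ (ℕ.≤-reflexive (sym r≡r′))))
            (≤⇒⊑ {fromℤ (+ rank c)} {fromℤ (+ rank c′)} (σ c)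
              (fromℤ-mono-≤ (+≤+ (rank-mono-≤ c⊑c′))))

        cancel : (fromℤ (+ rank c) , σ c) ⊑ (fromℤ (+ rank c′) , σ c′) → e c ⊑ e c′
        cancel r⊑r′ = rank-cancel-≤ (ℤ.drop‿+≤+ (fromℤ-cancel-≤
          (⊑⇒≤ {fromℤ (+ rank c)} {fromℤ (+ rank c′)} (σ c) (σ c′) r⊑r′)))

  -- Codes of boxes and the order of their ends

  remQuot-surjective : StrictlySurjective _≡_ (remQuot {2} n)
  remQuot-surjective (s , i) = combine s i , remQuot-combine s i

  -- A point is moved one coordinate at a time to a real beyond exactly the corresponding cuts, so
  -- it keeps its codeword.
  code-box-⊆ : ∀ s s′ (x x′ : Ends n d) →
    (∀ j c c′ → cuts s′ x′ j c ⊑ cuts s′ x′ j c′ → cuts s x j c ⊑ cuts s x j c′) →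
    code (box s x) ⊆ code (box s′ x′)
  code-box-⊆ s s′ x x′ reflects (p , h) = (proj₁ ∘ moved) , λ i → ⇔-trans (mk⇔
      (λ p′∈ j → from (proj₂ (moved j) (zero , i)) (proj₁ (p′∈ j)) ,
                 proj₂ (p′∈ j) ∘ to (proj₂ (moved j) (suc zero , i)))
      (λ p∈ j → to (proj₂ (moved j) (zero , i)) (proj₁ (p∈ j)) ,
                proj₂ (p∈ j) ∘ from (proj₂ (moved j) (suc zero , i))))
      (h i)
    where
    moved : ∀ j → ∃[ p′ ] ∀ c → cuts s x j c ⊑ (p j , ⁻) ⇔ cuts s′ x′ j c ⊑ (p′ , ⁻)
    moved j = order-transfer remQuot-surjective (cuts s x j) (cuts s′ x′ j) (reflects j) (p j)

  -- `remQuot` enumerates the ends by `Fin (2 * n)`, so these ranks lie between 1 and `2 * n`.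
  end-rank : Sign → Ends n d → Fin d → End n → ℕ
  end-rank s x j = rank remQuot-surjective (cuts s x j)

  rank-ends : Sign → Ends n d → Ends n d
  rank-ends s x j c = fromℤ (+ end-rank s x j c)

  -- Ranks taken with sign `s` may be read with sign `s′`: equivalent cuts are ends of the same kind
  -- and so agree in either sign.
  code-rank-ends : ∀ s s′ (x : Ends n d) → code (box s x) ≐ code (box s′ (rank-ends s x))
  code-rank-ends s s′ x =
    code-box-⊆ s s′ x (rank-ends s x) (λ j c c′ → from (order j c c′)) ,
    code-box-⊆ s′ s (rank-ends s x) x (λ j c c′ → to (order j c c′))
    where
    order : ∀ j c c′ →
      cuts s x j c ⊑ cuts s x j c′ ⇔ cuts s′ (rank-ends s x) j c ⊑ cuts s′ (rank-ends s x) j c′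
    order j = rank-cut-order remQuot-surjective (cuts s x j) (end-sign s′)
      λ c c′ c⊑c′ c′⊑c → end-sign-cong s s′ c c′
        (⊑-antisym-sign {x j c} {x j c′} c⊑c′ c′⊑c)

theorem16 : ExcludedMiddle 0ℓ →
  ∀ {ℓ : Level} (n d : ℕ) → 1 ≤ⁿ d → (𝒞 : Code n ℓ) →
  ((𝒰 : Vector (Pred (Point d) 0ℓ) n) → (∀ i → IsBox (𝒰 i)) → 𝒰 Realizes 𝒞 →
    Σ[ 𝒱 ∈ Vector (Pred (Point d) 0ℓ) n ]
      (∀ i → IsBox (𝒱 i)) × 𝒱 Realizes 𝒞 ×
      (∀ i → Satisfiable (𝒱 i) →
        Σ[ a ∈ Vector ℤ d ] Σ[ b ∈ Vector ℤ d ]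
          (∀ j → + 1 ≤ᶻ a j × a j ≤ᶻ b j × b j ≤ᶻ + (2 * n)) ×
          𝒱 i ≐ closedBox (fromℤ ∘ a) (fromℤ ∘ b)) ×
      (interior ∘ 𝒱) Realizes 𝒞) ×
  ((Σ[ 𝒰 ∈ Vector (Pred (Point d) 0ℓ) n ]
      (∀ i → IsBox (𝒰 i)) × (interior ∘ 𝒰) Realizes 𝒞) →
    Σ[ 𝒱 ∈ Vector (Pred (Point d) 0ℓ) n ]
      (∀ i → IsBox (𝒱 i)) × 𝒱 Realizes 𝒞)
theorem16 em {ℓ} n d 1≤d 𝒞 = closed , open′
  where
  open Classical em

  -- The sign tells whether closed or open boxes were ranked; the resulting box is closed in both
  -- cases.
  rankBox : Sign → Ends n d → Vector (Pred (Point d) 0ℓ) n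
  rankBox s x i = closedBox (lo (rank-ends s x) i) (hi (rank-ends s x) i)

  rankBox-isBox : ∀ s x i → IsBox (rankBox s x i)
  rankBox-isBox s x i = closedBox-isBox (lo (rank-ends s x) i) (hi (rank-ends s x) i)

  code-rankBox : ∀ s x → code (rankBox s x) ≐ code (box s x)
  code-rankBox s x = ≐-trans (code-cong λ i → ≐-sym (box⁻≐closedBox (rank-ends s x) i))
                             (≐-sym (code-rank-ends s ⁻ x))

  -- Passing to interiors keeps the corners and only turns the sign read on the ranks from `⁻` to
  -- `⁺`.
  code-interior-rankBox : ∀ s x → code (interior ∘ rankBox s x) ≐ code (box s x)
  code-interior-rankBox s x =
    ≐-trans (code-cong λ i → ≐-trans (interior-closedBox (lo (rank-ends s x) i) (hi (rank-ends s x) i))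
                                     (≐-sym (box⁺≐openBox (rank-ends s x) i)))
            (≐-sym (code-rank-ends s ⁺ x))

  module _ (𝒰 : Vector (Pred (Point d) 0ℓ) n) (boxes : ∀ i → IsBox (𝒰 i)) where

    corners : ∀ i → ∃₂ λ a b → 𝒰 i ≐ closedBox a b
    corners i = isBox⇒closedBox 1≤d (boxes i)

    u : Ends n d
    u = ends (proj₁ ∘ corners) (proj₁ ∘ proj₂ ∘ corners)

    𝒰≐ : ∀ i → 𝒰 i ≐ closedBox (lo u i) (hi u i)
    𝒰≐ = proj₂ ∘ proj₂ ∘ corners

    code-𝒰 : code (box ⁻ u) ≐ code 𝒰
    code-𝒰 = code-cong λ i → ≐-trans (box⁻≐closedBox u i) (≐-sym (𝒰≐ i))

    code-interior-𝒰 : code (box ⁺ u) ≐ code (interior ∘ 𝒰)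
    code-interior-𝒰 = code-cong λ i →
      ≐-trans (box⁺≐openBox u i)
              (≐-sym (≐-trans (interior-cong (𝒰≐ i)) (interior-closedBox (lo u i) (hi u i))))

  closed = λ 𝒰 boxes 𝒰-𝒞 → let x = u 𝒰 boxes; r = end-rank ⁻ x in
    rankBox ⁻ x ,
    rankBox-isBox ⁻ x ,
    ≐-trans (code-rankBox ⁻ x) (≐-trans (code-𝒰 𝒰 boxes) 𝒰-𝒞) ,
    (λ i (p , p∈) →
      (λ j → + r j (zero , i)) , (λ j → + r j (suc zero , i)) ,
      (λ j → +≤+ (1≤rank remQuot-surjective (cuts ⁻ x j) (zero , i)) ,
             -- The point `p` of the box lies between the two ends, which puts them in order.
             fromℤ-cancel-≤ (λ q<a → proj₂ (p∈ j) (proj₁ (p∈ j) q<a)) ,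
             +≤+ (rank≤m remQuot-surjective (cuts ⁻ x j) (suc zero , i))) ,
      id , id) ,
    ≐-trans (code-interior-rankBox ⁻ x) (≐-trans (code-𝒰 𝒰 boxes) 𝒰-𝒞)

  -- The cuts of the open boxes are ranked, and the ranks are then read as ends of closed boxes.
  open′ = λ (𝒰 , boxes , 𝒰-𝒞) → let x = u 𝒰 boxes in
    rankBox ⁺ x ,
    rankBox-isBox ⁺ x ,
    ≐-trans (code-rankBox ⁺ x) (≐-trans (code-interior-𝒰 𝒰 boxes) 𝒰-𝒞)
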